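{- Let $A$ be a set, let $Q$ be a predicate on $A$, and let $S$ be a binary relation on $A$. Let $wp(S,Q)$ and $wp(S,\lnot Q)$ be the weakest preconditions of $S$ with respect to the postconditions $Q$ and $\lnot Q$. Then $$\forall x\,\lnot\big(wp(S,Q)(x)\land wp(S,\lnot Q)(x)\big).$$
   Context: $A$ is an arbitrary set (the abstract state space); all quantified variables range over $A$. An $S$-predicate is a predicate $P:A\to\{\top,\bot\}$; an $S$-relation is an arbitrary binary relation $S\subseteq A\times A$, with $S(x,y)$ meaning $(x,y)\in S$ (neither totality nor determinism is assumed). Logical connectives applied to predicates are taken pointwise, so $\lnot Q$ is the predicate $x\mapsto\lnot Q(x)$. The total correctness formula $\{P\}S\{Q\}$ abbreviates $$\forall x\,[P(x)\Rightarrow(\exists y\,S(x,y)\ \land\ \forall z\,(S(x,z)\Rightarrow Q(z)))].$$ The weakest precondition of $S$ with respect to a postcondition $Q$ is an $S$-predicate $wp(S,Q)$ such that: (WP1) $\{wp(S,Q)\}S\{Q\}$; and (WP2) for every $S$-predicate $P$, $\{P\}S\{Q\}\Rightarrow\forall x\,(P(x)\Rightarrow wp(S,Q)(x))$. The logic is classical first-order predicate logic. -}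

module Defs where

open import Level using (Level; suc)
open import Data.Product using (∃; _×_)
open import Relation.Binary.Core using (Rel)
open import Relation.Unary using (Pred)

private
  variable
    ℓ : Level

-- The total correctness formula {P} S {Q}.  Neither totality nor determinism
-- of S is assumed; the first conjunct excludes states with no successor.
⟪_⟫_⟪_⟫ : {A : Set ℓ} → Pred A ℓ → Rel A ℓ → Pred A ℓ → Set ℓ
⟪ P ⟫ S ⟪ Q ⟫ = ∀ x → P x → ∃ (λ y → S x y) × (∀ z → S x z → Q z)

-- The states, the predicates and the relation share one level, so that the
-- class of predicates over which `weakest` quantifies contains every
-- first-order definable predicate, including the weakest precondition itself.
record IsWeakestPrecondition {A : Set ℓ} (S : Rel A ℓ) (Q wp : Pred A ℓ)
       : Set (suc ℓ) where
  field
    correct : ⟪ wp ⟫ S ⟪ Q ⟫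
    weakest : (P : Pred A ℓ) → ⟪ P ⟫ S ⟪ Q ⟫ → ∀ x → P x → wp x

{-# OPTIONS --safe #-}
module Submission where

open import Level using (Level)
open import Data.Product using (_×_; _,_)
open import Relation.Binary.Core using (Rel)
open import Relation.Nullary using (¬_)
open import Relation.Unary using (Pred; ∁)
open import Defs

-- Total correctness promises a successor as well as the postcondition at every successor. If both
-- preconditions held at `x`, some successor of `x` would satisfy `Q` and its negation at once.

theorem5p5 : {ℓ : Level} (A : Set ℓ) (Q : Pred A ℓ) (S : Rel A ℓ)
    (wpQ wp¬Q : Pred A ℓ) →
    IsWeakestPrecondition S Q wpQ →
    IsWeakestPrecondition S (∁ Q) wp¬Q →
    ∀ x → ¬ (wpQ x × wp¬Q x)
theorem5p5 A Q S wpQ wp¬Q isWpQ isWp¬Q x (p , p¬)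
  with IsWeakestPrecondition.correct isWpQ x p
     | IsWeakestPrecondition.correct isWp¬Q x p¬
-- The witness `y` comes from termination under `wpQ`; `∁ Q y` unfolds to `Q y → ⊥`, so it applies
-- directly to the proof of `Q y`.
... | (y , Sxy) , allQ | _ , all¬Q = all¬Q y Sxy (allQ y Sxy)
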